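{- Let $n \geqslant 2$ and let $G_1, \ldots, G_n$ be finite graphs, where $G_i$ has $v_i \geqslant 1$ vertices. Put $v = \sum_{i=1}^{n} v_i$ and let $G = G_1\nabla G_2\nabla\cdots\nabla G_n$ be their product. Let $\tau(G)$ be the number of spanning trees of $G$ and let $d_G(u)$ denote the degree of a vertex $u$ in $G$. Then $$\tau(G) \leqslant v^{n-2}\,\frac{\prod_{u\in V(G)} d_G(u)}{\prod_{i=1}^{n}(v-v_i)}.$$
   Context: Graphs are undirected, without loops and without multiple edges; the $G_i$ need not be connected. The product $G = G_1\nabla G_2\nabla\cdots\nabla G_n$ is the graph whose vertex set is the disjoint union $V(G)=\bigsqcup_{i=1}^n V(G_i)$ and whose edges are all edges of all the $G_i$ together with all pairs $xy$ with $x\in V(G_i)$, $y\in V(G_j)$, $1\leqslant i<j\leqslant n$ (so every two vertices from different $G_i$'s are adjacent). -}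

module Defs where

open import Data.Fin using (Fin; zero; suc)
import Data.Fin.Properties as Fin
open import Data.List using (List; []; _∷_; _++_; [_]; map; filter; concat; length; lookup; tabulate)
open import Data.List.Membership.Propositional using (_∈_; lose; find)
open import Data.List.Membership.Propositional.Properties
  using (∈-lookup; ∈-map⁺; ∈-map⁻; ∈-concat⁺′; ∈-tabulate⁺)
import Data.List.Membership.DecPropositional as DecMembership
open import Data.List.Relation.Unary.All using (all?)
import Data.List.Relation.Unary.All as All
import Data.List.Relation.Unary.All.Properties as All
open import Data.List.Relation.Unary.AllPairs using ([]; _∷_)
import Data.List.Relation.Unary.AllPairs.Properties as AllPairs
open import Data.List.Relation.Unary.Any using (here; there; any?; index)
open import Data.List.Relation.Unary.Any.Properties using (lookup-index)
open import Data.List.Relation.Unary.Linked using (Linked; linked?)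
open import Data.List.Relation.Unary.Unique.Propositional using (Unique)
import Data.List.Relation.Unary.Unique.Propositional.Properties as Unique
import Data.List.Relation.Unary.Unique.DecPropositional as DecUnique
open import Data.Nat using (ℕ; zero; suc; _∸_; _≤_; _<_; z≤n; s≤s; NonZero; >-nonZero)
open import Data.Nat.ListAction using (sum; product)
open import Data.Nat.ListAction.Properties using (product≢0)
import Data.Nat.Properties as ℕ
open import Data.Product using (Σ; ∃; _×_; _,_)
open import Data.Product.Properties using (≡-dec)
open import Data.Sum using (_⊎_; inj₁; inj₂)
open import Function using (_∘_)
open import Function.Definitions using (Injective)
open import Level using (0ℓ)
open import Relation.Binary using (Rel; Decidable; DecidableEquality; Symmetric)
open import Relation.Binary.Construct.Closure.ReflexiveTransitive using (Star; ε; _◅_; _◅◅_)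
open import Relation.Binary.PropositionalEquality
  using (_≡_; _≢_; refl; sym; trans; cong)
open import Relation.Nullary using (Dec; yes; no; ¬_; ¬?; contradiction)
open import Relation.Nullary.Decidable using (map′; _×-dec_; _⊎-dec_)
import Relation.Unary as U

record FiniteGraph : Set₁ where
  field
    V        : Set
    vertices : List V
    complete : ∀ x → x ∈ vertices
    unique   : Unique vertices
    _~_      : Rel V 0ℓ
    _~?_     : Decidable _~_
    ~-sym    : Symmetric _~_
    ~-irrefl : ∀ {x} → ¬ (x ~ x)

  order : ℕ
  order = length vertices

  degree : V → ℕ
  degree x = length (filter (x ~?_) vertices)

  position : V → Fin order
  position x = index (complete x)

  position-injective : Injective _≡_ _≡_ position
  position-injective {x} {y} eq =
    trans (lookup-index (complete x))
      (trans (cong (lookup vertices) eq) (sym (lookup-index (complete y))))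

  _≟_ : DecidableEquality V
  x ≟ y = map′ position-injective (cong position) (position x Fin.≟ position y)

pairs : {A : Set} → List A → List (A × A)
pairs []       = []
pairs (x ∷ xs) = map (x ,_) xs ++ pairs xs

sublists : {A : Set} → List A → List (List A)
sublists []       = [ [] ]
sublists (x ∷ xs) = map (x ∷_) (sublists xs) ++ sublists xs

module _ {A : Set} where

  Connected : Rel A 0ℓ → Set
  Connected R = ∀ x y → Star R x y

  data IsCycle (R : Rel A 0ℓ) : List A → Set where
    cycle : ∀ {x y z zs} →
            Unique (x ∷ y ∷ z ∷ zs) →
            Linked R (x ∷ y ∷ z ∷ zs ++ [ x ]) →
            IsCycle R (x ∷ y ∷ z ∷ zs)

  Acyclic : Rel A 0ℓ → Set
  Acyclic R = ¬ ∃ (IsCycle R)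

  IsTree : Rel A 0ℓ → Set
  IsTree R = Connected R × Acyclic R

  -- A list of ordered pairs, read as a set of undirected edges.
  Joined : List (A × A) → Rel A 0ℓ
  Joined F x y = (x , y) ∈ F ⊎ (y , x) ∈ F

module _ (G : FiniteGraph) where
  open FiniteGraph G

  _≟ₑ_ : DecidableEquality (V × V)
  _≟ₑ_ = ≡-dec _≟_ _≟_

  open DecMembership _≟ₑ_ using (_∈?_)
  open DecUnique _≟_ using (unique?)

  ∃? : {P : V → Set} → U.Decidable P → Dec (∃ P)
  ∃? P? = map′ (λ p → let x , _ , px = find p in x , px)
               (λ (x , px) → lose (complete x) px)
               (any? P? vertices)

  ∀? : {P : V → Set} → U.Decidable P → Dec (∀ x → P x)
  ∀? P? = map′ (λ ps x → All.lookup ps (complete x))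
               (λ f → All.tabulate (λ {x} _ → f x))
               (all? P? vertices)

  ∃-short? : {P : List V → Set} → U.Decidable P →
             ∀ k → Dec (∃ λ xs → length xs ≤ k × P xs)
  ∃-short? P? zero = map′ (λ p → [] , z≤n , p) (λ { ([] , _ , p) → p }) (P? [])
  ∃-short? P? (suc k) =
    map′ (λ { (inj₁ p)                → [] , z≤n , p
            ; (inj₂ (x , xs , l , p)) → x ∷ xs , s≤s l , p })
         (λ { ([] , _ , p)            → inj₁ p
            ; (x ∷ xs , s≤s l , p)    → inj₂ (x , xs , l , p) })
         (P? [] ⊎-dec ∃? (λ x → ∃-short? (λ xs → P? (x ∷ xs)) k))

  lookup-injective : ∀ {xs : List V} → Unique xs → Injective _≡_ _≡_ (lookup xs)
  lookup-injective (_ ∷ _) {zero}  {zero}  _  = refl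
  lookup-injective (p ∷ _) {zero}  {suc j} eq = contradiction eq (All.lookup p (∈-lookup j))
  lookup-injective (p ∷ _) {suc i} {zero}  eq = contradiction (sym eq) (All.lookup p (∈-lookup i))
  lookup-injective (_ ∷ u) {suc i} {suc j} eq = cong suc (lookup-injective u eq)

  unique⇒short : ∀ {xs} → Unique xs → length xs ≤ order
  unique⇒short u = Fin.injective⇒≤ (lookup-injective u ∘ position-injective)

  module _ {R : Rel V 0ℓ} (R? : Decidable R) where

    -- Warshall's algorithm: walks whose interior vertices lie in the list.
    Via : List V → Rel V 0ℓ
    Via []       x y = x ≡ y ⊎ R x y
    Via (w ∷ ws) x y = Via ws x y ⊎ (Via ws x w × Via ws w y)

    via? : ∀ ws → Decidable (Via ws)
    via? []       x y = (x ≟ y) ⊎-dec R? x y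
    via? (w ∷ ws) x y = via? ws x y ⊎-dec (via? ws x w ×-dec via? ws w y)

    via⇒star : ∀ ws {x y} → Via ws x y → Star R x y
    via⇒star []       (inj₁ refl)    = ε
    via⇒star []       (inj₂ r)       = r ◅ ε
    via⇒star (w ∷ ws) (inj₁ p)       = via⇒star ws p
    via⇒star (w ∷ ws) (inj₂ (p , q)) = via⇒star ws p ◅◅ via⇒star ws q

    via-base : ∀ ws {x y} → Via [] x y → Via ws x y
    via-base []       p = p
    via-base (w ∷ ws) p = inj₁ (via-base ws p)

    via-to : ∀ {w ws x} → Via (w ∷ ws) x w → Via ws x w
    via-to (inj₁ p)       = p
    via-to (inj₂ (p , _)) = p

    via-from : ∀ {w ws y} → Via (w ∷ ws) w y → Via ws w y
    via-from (inj₁ p)       = p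
    via-from (inj₂ (_ , p)) = p

    via-trans : ∀ {ws w x y} → w ∈ ws → Via ws x w → Via ws w y → Via ws x y
    via-trans {_ ∷ ws} (here refl) p              q              =
      inj₂ (via-to {ws = ws} p , via-from {ws = ws} q)
    via-trans          (there w∈)  (inj₁ p)       (inj₁ q)       = inj₁ (via-trans w∈ p q)
    via-trans          (there w∈)  (inj₁ p)       (inj₂ (q , r)) = inj₂ (via-trans w∈ p q , r)
    via-trans          (there w∈)  (inj₂ (p , q)) (inj₁ r)       = inj₂ (p , via-trans w∈ q r)
    via-trans          (there w∈)  (inj₂ (p , _)) (inj₂ (_ , r)) = inj₂ (p , r)

    star⇒via : ∀ {x y} → Star R x y → Via vertices x y
    star⇒via ε = via-base vertices (inj₁ refl)
    star⇒via (_◅_ {j = z} r rs) =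
      via-trans (complete z) (via-base vertices (inj₂ r)) (star⇒via rs)

    connected? : Dec (Connected R)
    connected? = ∀? λ x → ∀? λ y →
      map′ (via⇒star vertices) star⇒via (via? vertices x y)

    isCycle? : U.Decidable (IsCycle R)
    isCycle? []               = no λ ()
    isCycle? (_ ∷ [])         = no λ ()
    isCycle? (_ ∷ _ ∷ [])     = no λ ()
    isCycle? (x ∷ y ∷ z ∷ zs) =
      map′ (λ (u , l) → cycle u l) (λ { (cycle u l) → u , l })
           (unique? (x ∷ y ∷ z ∷ zs) ×-dec linked? R? (x ∷ y ∷ z ∷ zs ++ [ x ]))

    acyclic? : Dec (Acyclic R)
    acyclic? = ¬? (map′ (λ (c , _ , p) → c , p)
                        (λ { (c , p@(cycle u _)) → c , unique⇒short u , p })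
                        (∃-short? isCycle? order))

    isTree? : Dec (IsTree R)
    isTree? = connected? ×-dec acyclic?

  joined? : ∀ F → Decidable (Joined {V} F)
  joined? F x y = ((x , y) ∈? F) ⊎-dec ((y , x) ∈? F)

  -- Each edge is listed once, oriented by the order of `vertices`, so the
  -- sublists of `edges` are exactly the edge sets of spanning subgraphs.
  edges : List (V × V)
  edges = filter (λ (x , y) → x ~? y) (pairs vertices)

  τ : ℕ
  τ = length (filter (λ F → isTree? (joined? F)) (sublists edges))

open FiniteGraph public using (vertices; order; degree)

module _ {n : ℕ} (G : Fin n → FiniteGraph) where
  private module G i = FiniteGraph (G i)

  data JoinAdj : Rel (Σ (Fin n) G.V) 0ℓ where
    inside : ∀ {i x y} → G._~_ i x y → JoinAdj (i , x) (i , y)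
    across : ∀ {i j x y} → i ≢ j → JoinAdj (i , x) (j , y)

  joinAdj? : Decidable JoinAdj
  joinAdj? (i , x) (j , y) with i Fin.≟ j
  ... | no i≢j   = yes (across i≢j)
  ... | yes refl = map′ inside
                        (λ { (inside a) → a ; (across i≢i) → contradiction refl i≢i })
                        (G._~?_ i x y)

  joinAdj-sym : Symmetric JoinAdj
  joinAdj-sym (inside a)   = inside (G.~-sym _ a)
  joinAdj-sym (across i≢j) = across (i≢j ∘ sym)

  joinAdj-irrefl : ∀ {x} → ¬ JoinAdj x x
  joinAdj-irrefl (inside a)   = G.~-irrefl _ a
  joinAdj-irrefl (across i≢i) = i≢i refl

  block : Fin n → List (Σ (Fin n) G.V)
  block i = map (i ,_) (G.vertices i)

  joinVertices : List (Σ (Fin n) G.V)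
  joinVertices = concat (tabulate block)

  joinVertices-unique : Unique joinVertices
  joinVertices-unique = Unique.concat⁺
    (All.tabulate⁺ λ i → Unique.map⁺ (λ { refl → refl }) (G.unique i))
    (AllPairs.tabulate⁺ λ i≢j (p , q) → disjoint i≢j (∈-map⁻ _ p) (∈-map⁻ _ q))
    where
    disjoint : ∀ {i j z} → i ≢ j →
               (∃ λ x → x ∈ G.vertices i × z ≡ (i , x)) →
               ¬ (∃ λ y → y ∈ G.vertices j × z ≡ (j , y))
    disjoint i≢j (_ , _ , refl) (_ , _ , refl) = i≢j refl

  ∇ : FiniteGraph
  ∇ = record
    { V        = Σ (Fin n) G.V
    ; vertices = joinVertices
    ; complete = λ (i , x) → ∈-concat⁺′ (∈-map⁺ (i ,_) (G.complete i x)) (∈-tabulate⁺ i)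
    ; unique   = joinVertices-unique
    ; _~_      = JoinAdj
    ; _~?_     = joinAdj?
    ; ~-sym    = joinAdj-sym
    ; ~-irrefl = joinAdj-irrefl
    }

≤sum : ∀ {n} (f : Fin n → ℕ) i → f i ≤ sum (tabulate f)
≤sum f zero    = ℕ.m≤m+n _ _
≤sum f (suc i) = ℕ.≤-trans (≤sum (f ∘ suc) i) (ℕ.m≤n+m _ (f zero))

<sum : ∀ {n} (f : Fin n → ℕ) → 2 ≤ n → (∀ i → 1 ≤ f i) → ∀ i → f i < sum (tabulate f)
<sum {suc (suc _)} f _ 1≤f zero    =
  ℕ.m<m+n (f zero) (ℕ.≤-trans (1≤f (suc zero)) (≤sum (f ∘ suc) zero))
<sum {suc (suc _)} f _ 1≤f (suc i) = ℕ.+-mono-≤ (1≤f zero) (≤sum (f ∘ suc) i)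
<sum {suc zero} _ (s≤s ())

∏[v∸vᵢ]≢0 : ∀ {n} (G : Fin n → FiniteGraph) → 2 ≤ n → (∀ i → 1 ≤ order (G i)) →
            NonZero (product (tabulate λ i → sum (tabulate (λ j → order (G j))) ∸ order (G i)))
∏[v∸vᵢ]≢0 G 2≤n 1≤v =
  product≢0 (All.tabulate⁺ λ i → >-nonZero (ℕ.m<n⇒0<n∸m (<sum (order ∘ G) 2≤n 1≤v i)))

{-# OPTIONS --safe #-}

-- Count triples (r , T , w) of a root r, a spanning tree T and a choice w of a
-- vertex outside each block: there are v·τ(G)·∏(v − vᵢ) of them.  Orient T
-- towards r and call a vertex crossing if it is r or its parent lies in another
-- block.  Two vertices u and u′ that are still unattached can be merged: hang u′
-- onto u, let u keep one of their two parents and put the other aside as a label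
-- of u′, interchanging the two when u lies below u′.  The result is again a
-- rooted tree, and the merge can be undone, because an interchange has happened
-- exactly when the label lies below u′.  Merge the crossing vertices of each
-- block into one of them, the labels being vertices outside that block, and then
-- the remaining n crossing vertices into one.  What is left is a choice of a
-- neighbour for every vertex (with w filling the n empty places) together with
-- n − 1 arbitrary vertices, so that v·τ(G)·∏(v − vᵢ) ≤ v^(n−1)·∏ d(u).

module Submission where

open import Defs
open import Data.Bool using (Bool; true; false; not)
import Data.Bool.Properties as Bool
open import Data.Empty using (⊥)
open import Data.Fin using (Fin; zero; suc; fromℕ<)
import Data.Fin.Properties as Fin
open import Data.Integer using (+_; +≤+)
import Data.Integer as ℤ
import Data.Integer.Properties as ℤ
open import Data.List
  using (List; []; _∷_; _++_; map; tabulate; concat; length; lookup; filter;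
         cartesianProductWith; cartesianProduct)
import Data.List.Properties as List
open import Data.List.Membership.Propositional using (_∈_; _∉_)
open import Data.List.Membership.Propositional.Properties
  using (∈-lookup; ∈-map⁺; ∈-map⁻; ∈-++⁻; ∈-filter⁺; ∈-filter⁻; ∈-tabulate⁺; ∈-tabulate⁻;
         ∈-cartesianProductWith⁺; ∈-cartesianProductWith⁻;
         ∈-cartesianProduct⁺; ∈-cartesianProduct⁻)
import Data.List.Membership.DecPropositional as DecMembership
open import Data.List.Relation.Unary.All using ([]; _∷_)
import Data.List.Relation.Unary.All as All
import Data.List.Relation.Unary.All.Properties as All
open import Data.List.Relation.Unary.AllPairs using ([]; _∷_)
open import Data.List.Relation.Unary.Any using (here; there; index)
open import Data.List.Relation.Unary.Any.Properties using (lookup-index)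
open import Data.List.Relation.Unary.Linked using (Linked; [-]; _∷_)
open import Data.List.Relation.Unary.Unique.Propositional using (Unique)
import Data.List.Relation.Unary.Unique.Propositional.Properties as Unique
open import Data.Maybe using (Maybe; just; nothing; _<∣>_)
import Data.Maybe.Properties as Maybe
open import Data.Nat
  using (ℕ; zero; suc; _+_; _*_; _∸_; _^_; _≤_; z≤n; s≤s; NonZero; >-nonZero)
open import Data.Nat.ListAction using (sum; product)
import Data.Nat.Properties as ℕ
open import Data.Product using (Σ; ∃; _×_; _,_; proj₁; proj₂)
open import Data.Rational using (_/_; toℚᵘ) renaming (_≤_ to _≤ℚ_; _*_ to _*ℚ_)
import Data.Rational.Properties as ℚ
import Data.Rational.Unnormalised as ℚᵘ
import Data.Rational.Unnormalised.Properties as ℚᵘ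
open import Data.Sum using (_⊎_; inj₁; inj₂; [_,_]′; swap)
open import Data.Vec using (Vec)
import Data.Vec as Vec
import Data.Vec.Properties as Vec
open import Function using (_∘_)
open import Level using (0ℓ)
open import Relation.Binary using (Rel; DecidableEquality)
open import Relation.Binary.Construct.Closure.ReflexiveTransitive using (Star; ε; _◅_; _◅◅_)
import Relation.Binary.Construct.Closure.ReflexiveTransitive as Star
open import Relation.Binary.PropositionalEquality
  using (_≡_; _≢_; _≗_; refl; sym; trans; cong; cong₂; cong-app; subst)
open import Relation.Nullary using (¬_; Dec; does; yes; no; ¬?; contradiction)
open import Relation.Nullary.Decidable using (map′; _×-dec_; dec-false)
import Relation.Unary as U

-- Counting

lookup-unique : ∀ {A : Set} {xs : List A} → Unique xs → ∀ {i j} → lookup xs i ≡ lookup xs j → i ≡ j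
lookup-unique (_ ∷ _) {zero}  {zero}  _  = refl
lookup-unique (p ∷ _) {zero}  {suc j} eq = contradiction eq (All.lookup p (∈-lookup j))
lookup-unique (p ∷ _) {suc i} {zero}  eq = contradiction (sym eq) (All.lookup p (∈-lookup i))
lookup-unique (_ ∷ u) {suc i} {suc j} eq = cong suc (lookup-unique u eq)

length-≤-by : ∀ {A B : Set} {xs : List A} {ys : List B} (R : A → B → Set) → Unique xs →
              (∀ {x} → x ∈ xs → ∃ λ y → y ∈ ys × R x y) →
              (∀ {x x′ y} → R x y → R x′ y → x ≡ x′) →
              length xs ≤ length ys
length-≤-by {xs = xs} {ys} R u code inj = Fin.injective⇒≤ {f = f} f-injective
  where
  f : Fin (length xs) → Fin (length ys)
  f i = index (proj₁ (proj₂ (code (∈-lookup i))))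

  R-lookup : ∀ i → R (lookup xs i) (lookup ys (f i))
  R-lookup i = let _ , y∈ , r = code (∈-lookup i) in subst (R _) (lookup-index y∈) r

  f-injective : ∀ {i j} → f i ≡ f j → i ≡ j
  f-injective {i} {j} eq = lookup-unique u
    (inj (R-lookup i) (subst (λ k → R (lookup xs j) (lookup ys k)) (sym eq) (R-lookup j)))

length-cartesianProductWith : ∀ {A B C : Set} (f : A → B → C) xs ys →
  length (cartesianProductWith f xs ys) ≡ length xs * length ys
length-cartesianProductWith f []       ys = refl
length-cartesianProductWith f (x ∷ xs) ys =
  trans (List.length-++ (map (f x) ys))
        (cong₂ _+_ (List.length-map (f x) ys) (length-cartesianProductWith f xs ys))

choices : ∀ {A : Set} {n} → (Fin n → List A) → List (Vec A n)
choices {n = zero}  L = Vec.[] ∷ []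
choices {n = suc n} L = cartesianProductWith Vec._∷_ (L zero) (choices (L ∘ suc))

length-choices : ∀ {A : Set} {n} (L : Fin n → List A) →
                 length (choices L) ≡ product (tabulate (length ∘ L))
length-choices {n = zero}  L = refl
length-choices {n = suc n} L =
  trans (length-cartesianProductWith Vec._∷_ (L zero) _)
        (cong (length (L zero) *_) (length-choices (L ∘ suc)))

choices-unique : ∀ {A : Set} {n} {L : Fin n → List A} → (∀ i → Unique (L i)) → Unique (choices L)
choices-unique {n = zero}  u = [] ∷ []
choices-unique {n = suc n} u =
  Unique.cartesianProductWith⁺ Vec._∷_ (λ { refl → refl , refl }) (u zero) (choices-unique (u ∘ suc))

∈-choices⁺ : ∀ {A : Set} {n} {L : Fin n → List A} {f : Fin n → A} → (∀ i → f i ∈ L i) →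
             Vec.tabulate f ∈ choices L
∈-choices⁺ {n = zero}  f∈ = here refl
∈-choices⁺ {n = suc n} f∈ = ∈-cartesianProductWith⁺ Vec._∷_ (f∈ zero) (∈-choices⁺ (f∈ ∘ suc))

∈-choices⁻ : ∀ {A : Set} {n} {L : Fin n → List A} {v} → v ∈ choices L → ∀ i → Vec.lookup v i ∈ L i
∈-choices⁻ {n = suc n} {L} v∈ i with ∈-cartesianProductWith⁻ Vec._∷_ (L zero) _ v∈
∈-choices⁻ {n = suc n} v∈ zero    | _ , _ , a∈ , _  , refl = a∈
∈-choices⁻ {n = suc n} v∈ (suc i) | _ , _ , _  , w∈ , refl = ∈-choices⁻ w∈ i

tabulate-injective : ∀ {A : Set} {n} {f g : Fin n → A} → Vec.tabulate f ≡ Vec.tabulate g → ∀ i → f i ≡ g i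
tabulate-injective {f = f} {g} eq i =
  trans (sym (Vec.lookup∘tabulate f i)) (trans (cong (λ v → Vec.lookup v i) eq) (Vec.lookup∘tabulate g i))

product-tabulate-mono : ∀ {n} {f g : Fin n → ℕ} → (∀ i → f i ≤ g i) →
                        product (tabulate f) ≤ product (tabulate g)
product-tabulate-mono {zero}  f≤g = ℕ.≤-refl
product-tabulate-mono {suc n} f≤g = ℕ.*-mono-≤ (f≤g zero) (product-tabulate-mono (f≤g ∘ suc))

product-tabulate-const : ∀ n c → product (tabulate {n = n} (λ _ → c)) ≡ c ^ n
product-tabulate-const zero    c = refl
product-tabulate-const (suc n) c = cong (c *_) (product-tabulate-const n c)

length-filter-¬ : ∀ {A : Set} {P : A → Set} (P? : U.Decidable P) xs →
                  length xs ≡ length (filter P? xs) + length (filter (¬? ∘ P?) xs)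
length-filter-¬ P? []       = refl
length-filter-¬ P? (x ∷ xs) with P? x
... | yes _ = cong suc (length-filter-¬ P? xs)
... | no  _ = trans (cong suc (length-filter-¬ P? xs)) (sym (ℕ.+-suc _ _))

module _ {A : Set} where

  ∈-pairs⁻ : ∀ {xs : List A} {a b} → (a , b) ∈ pairs xs → a ∈ xs × b ∈ xs
  ∈-pairs⁻ {x ∷ xs} ab∈ with ∈-++⁻ (map (x ,_) xs) ab∈
  ... | inj₂ q = let a∈ , b∈ = ∈-pairs⁻ q in there a∈ , there b∈
  ... | inj₁ q with ∈-map⁻ (x ,_) q
  ...   | _ , b∈ , refl = here refl , there b∈

  pairs-asym : ∀ {xs : List A} {a b} → Unique xs → (a , b) ∈ pairs xs → (b , a) ∉ pairs xs
  pairs-asym {x ∷ xs} (x≢ ∷ u) ab∈ ba∈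
    with ∈-++⁻ (map (x ,_) xs) ab∈ | ∈-++⁻ (map (x ,_) xs) ba∈
  ... | inj₂ p | inj₂ q = pairs-asym u p q
  ... | inj₁ p | q′ with ∈-map⁻ (x ,_) p
  ...   | _ , b∈ , refl with q′
  ...     | inj₂ q = All.lookup x≢ (proj₂ (∈-pairs⁻ q)) refl
  ...     | inj₁ q with ∈-map⁻ (x ,_) q
  ...       | _ , _ , refl = All.lookup x≢ b∈ refl
  pairs-asym {x ∷ xs} (x≢ ∷ u) ab∈ ba∈ | inj₂ p | inj₁ q with ∈-map⁻ (x ,_) q
  ... | _ , _ , refl = All.lookup x≢ (proj₂ (∈-pairs⁻ p)) refl

  pairs-unique : ∀ {xs : List A} → Unique xs → Unique (pairs xs)
  pairs-unique []       = []
  pairs-unique {x ∷ xs} (x≢ ∷ u) =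
    Unique.++⁺ (Unique.map⁺ (λ { refl → refl }) u) (pairs-unique u) disjoint
    where
    disjoint : ∀ {e} → ¬ (e ∈ map (x ,_) xs × e ∈ pairs xs)
    disjoint (p , q) with ∈-map⁻ (x ,_) p
    ... | _ , _ , refl = All.lookup x≢ (proj₁ (∈-pairs⁻ q)) refl

  ∈-sublists⁻ : ∀ {xs ys : List A} {z} → ys ∈ sublists xs → z ∈ ys → z ∈ xs
  ∈-sublists⁻ {[]}     (here refl) z∈ = z∈
  ∈-sublists⁻ {x ∷ xs} ys∈ z∈ with ∈-++⁻ (map (x ∷_) (sublists xs)) ys∈
  ... | inj₂ q = there (∈-sublists⁻ q z∈)
  ... | inj₁ q with ∈-map⁻ (x ∷_) q
  ...   | _ , q′ , refl with z∈
  ...     | here eq   = here eq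
  ...     | there z∈′ = there (∈-sublists⁻ q′ z∈′)

  sublists-unique : ∀ {xs : List A} → Unique xs → Unique (sublists xs)
  sublists-unique []       = [] ∷ []
  sublists-unique {x ∷ xs} (x≢ ∷ u) =
    Unique.++⁺ (Unique.map⁺ List.∷-injectiveʳ (sublists-unique u)) (sublists-unique u) disjoint
    where
    disjoint : ∀ {ys} → ¬ (ys ∈ map (x ∷_) (sublists xs) × ys ∈ sublists xs)
    disjoint (p , q) with ∈-map⁻ (x ∷_) p
    ... | _ , _ , refl = All.lookup x≢ (∈-sublists⁻ q (here refl)) refl

  sublists-ext : ∀ {xs ys zs : List A} → Unique xs → ys ∈ sublists xs → zs ∈ sublists xs →
                 (∀ {e} → e ∈ ys → e ∈ zs) → (∀ {e} → e ∈ zs → e ∈ ys) → ys ≡ zs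
  sublists-ext {[]} u (here refl) (here refl) _ _ = refl
  sublists-ext {x ∷ xs} (x≢ ∷ u) p q to from
    with ∈-++⁻ (map (x ∷_) (sublists xs)) p | ∈-++⁻ (map (x ∷_) (sublists xs)) q
  ... | inj₂ p′ | inj₂ q′ = sublists-ext u p′ q′ to from
  ... | inj₁ p′ | inj₂ q′ with ∈-map⁻ (x ∷_) p′
  ...   | _ , _ , refl = contradiction refl (All.lookup x≢ (∈-sublists⁻ q′ (to (here refl))))
  sublists-ext {x ∷ xs} (x≢ ∷ u) p q to from
      | inj₂ p′ | inj₁ q′ with ∈-map⁻ (x ∷_) q′
  ...   | _ , _ , refl = contradiction refl (All.lookup x≢ (∈-sublists⁻ p′ (from (here refl))))
  sublists-ext {x ∷ xs} (x≢ ∷ u) p q to from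
      | inj₁ p′ | inj₁ q′ with ∈-map⁻ (x ∷_) p′ | ∈-map⁻ (x ∷_) q′
  ...   | ys , p″ , refl | zs , q″ , refl =
    cong (x ∷_) (sublists-ext u p″ q″ (restrict p″ to) (restrict q″ from))
    where
    restrict : ∀ {as bs} → as ∈ sublists xs → (∀ {e} → e ∈ x ∷ as → e ∈ x ∷ bs) →
               ∀ {e} → e ∈ as → e ∈ bs
    restrict as∈ f e∈ with f (there e∈)
    ... | there e∈′ = e∈′
    ... | here refl = contradiction refl (All.lookup x≢ (∈-sublists⁻ as∈ e∈))

-- Regrafting parent functions

module _ {V : Set} where

  Arc : (V → Maybe V) → V → V → Set
  Arc p x y = p x ≡ just y

  Reach : (V → Maybe V) → V → V → Set
  Reach p = Star (Arc p)

  Rooted : (V → Maybe V) → V → Set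
  Rooted p r = p r ≡ nothing × ∀ x → Reach p x r

  just-functional : ∀ {m : Maybe V} {y z} → m ≡ just y → m ≡ just z → y ≡ z
  just-functional e e′ = Maybe.just-injective (trans (sym e) e′)

  nothing≢just : ∀ {m : Maybe V} {y} → m ≡ nothing → m ≡ just y → ⊥
  nothing≢just refl ()

  reach-cong : ∀ {p q} → p ≗ q → ∀ {x y} → Reach p x y → Reach q x y
  reach-cong eq = Star.map (λ {x} e → trans (sym (eq x)) e)

  reach-tail : ∀ {p x y z} → Arc p x z → x ≢ y → Reach p x y → Reach p z y
  reach-tail e x≢y ε       = contradiction refl x≢y
  reach-tail e x≢y (e′ ◅ s) = subst (λ w → Reach _ w _) (just-functional e′ e) s

  root-unique : ∀ {p r s} → Rooted p r → p s ≡ nothing → s ≡ r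
  root-unique {s = s} (_ , reach) ps with reach s
  ... | ε     = refl
  ... | e ◅ _ = contradiction e (nothing≢just ps)

  rooted-acyclic : ∀ {p r} → Rooted p r → ∀ {x z} → Arc p x z → ¬ Reach p z x
  rooted-acyclic {p} {r} (pr , reach) = go (reach _)
    where
    go : ∀ {x} → Reach p x r → ∀ {z} → Arc p x z → ¬ Reach p z x
    go ε e _ = nothing≢just pr e
    go (e′ ◅ s) e c with just-functional e′ e
    go (e′ ◅ s) e ε        | refl = go s e ε
    go (e′ ◅ s) e (e″ ◅ c) | refl = go s e″ (c ◅◅ (e ◅ ε))

  -- The subtree below u′ is hung onto u.  Of the two old values at u and u′
  -- one becomes the value at u and the other is set aside as a label: the two
  -- are interchanged exactly when u lies below u′, as otherwise hanging u′
  -- onto u would close a cycle.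
  record Regraft (p p′ : V → Maybe V) (label : Maybe V) (u u′ : V) : Set where
    field
      u≢u′  : u ≢ u′
      hung  : p′ u′ ≡ just u
      agree : ∀ {x} → x ≢ u → x ≢ u′ → p′ x ≡ p x
      value : (¬ Reach p u u′ × p′ u ≡ p u  × label ≡ p u′)
            ⊎ (  Reach p u u′ × p′ u ≡ p u′ × label ≡ p u)

  module Regrafting (_≟_ : DecidableEquality V)
                    {p p′ label u u′} (regraft : Regraft p p′ label u u′) where
    open Regraft regraft

    avoiding : ∀ {x y} → ¬ Reach p x u → ¬ Reach p x u′ → Reach p x y → Reach p′ x y
    avoiding _    _     ε       = ε
    avoiding x↝̸u x↝̸u′ (e ◅ s) =
      trans (agree (λ { refl → x↝̸u ε }) (λ { refl → x↝̸u′ ε })) e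
      ◅ avoiding (x↝̸u ∘ (e ◅_)) (x↝̸u′ ∘ (e ◅_)) s

    redirect : ∀ {r s} → (r ≢ u → r ≢ u′ → r ≡ s) → Reach p′ u s →
               ∀ {x} → Reach p x r → Reach p′ x s
    redirect r≡s u↝s {x} x↝r with x ≟ u | x ≟ u′
    ... | yes refl | _        = u↝s
    ... | no _     | yes refl = hung ◅ u↝s
    redirect r≡s u↝s ε       | no x≢u | no x≢u′ =
      subst (Reach p′ _) (r≡s x≢u x≢u′) ε
    redirect r≡s u↝s (e ◅ s) | no x≢u | no x≢u′ =
      trans (agree x≢u x≢u′) e ◅ redirect r≡s u↝s s

    module _ {r} (root : Rooted p r) where

      private
        acyclic = rooted-acyclic root

        rooted-at : ∀ a → a ≡ u ⊎ a ≡ u′ → p′ u ≡ p a →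
                    (∀ {z} → Arc p a z → ¬ Reach p z u × ¬ Reach p z u′) → ∃ (Rooted p′)
        rooted-at a a∈ eq avoids with p a in pa
        ... | nothing = u , eq , λ x → redirect (λ r≢u r≢u′ → contradiction a∈ (λ
                { (inj₁ refl) → r≢u (sym (root-unique root pa))
                ; (inj₂ refl) → r≢u′ (sym (root-unique root pa)) })) ε (proj₂ root x)
        ... | just z =
          let z↝̸u , z↝̸u′ = avoids refl
              z↝r = proj₂ root z
          in r , trans (agree (λ { refl → z↝̸u z↝r }) (λ { refl → z↝̸u′ z↝r })) (proj₁ root)
               , λ x → redirect (λ _ _ → refl) (eq ◅ avoiding z↝̸u z↝̸u′ z↝r) (proj₂ root x)

      regraft-rooted : ∃ (Rooted p′)
      regraft-rooted with value
      ... | inj₁ (u↝̸u′ , eq , _) =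
        rooted-at u (inj₁ refl) eq (λ e → acyclic e , λ z↝u′ → u↝̸u′ (e ◅ z↝u′))
      ... | inj₂ (u↝u′ , eq , _) =
        rooted-at u′ (inj₂ refl) eq (λ e → (λ z↝u → acyclic e (z↝u ◅◅ u↝u′)) , acyclic e)

      label≢nothing : label ≢ nothing
      label≢nothing eq with value
      ... | inj₁ (u↝̸u′ , _ , l) =
        u↝̸u′ (subst (Reach p u) (sym (root-unique root (trans (sym l) eq))) (proj₂ root u))
      ... | inj₂ (ε , _ , l)     = u≢u′ refl
      ... | inj₂ (e ◅ _ , _ , l) = nothing≢just (trans (sym l) eq) e

      kept-label : ¬ Reach p u u′ → ∀ {y} → Arc p u′ y → p′ u ≡ p u → ¬ Reach p′ y u′
      kept-label u↝̸u′ e eq = acyclic e ∘ back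
        where
        back : ∀ {x} → Reach p′ x u′ → Reach p x u′
        back {x} s with x ≟ u | x ≟ u′
        ... | _ | yes refl = ε
        back ε        | _        | no x≢u′ = contradiction refl x≢u′
        back (e′ ◅ s) | yes refl | no _    = trans (sym eq) e′ ◅ back s
        back (e′ ◅ s) | no x≢u   | no x≢u′ = trans (sym (agree x≢u x≢u′)) e′ ◅ back s

      swapped-label : Reach p u u′ → ∀ {y} → Arc p u y → Reach p′ y u′
      swapped-label u↝u′ e = forth (acyclic e) (reach-tail e u≢u′ u↝u′)
        where
        forth : ∀ {x} → ¬ Reach p x u → Reach p x u′ → Reach p′ x u′
        forth _    ε        = ε
        forth {x} x↝̸u s@(e′ ◅ s′) with x ≟ u′
        ... | yes refl = ε
        ... | no x≢u′  = trans (agree (λ { refl → x↝̸u ε }) x≢u′) e′ ◅ forth (x↝̸u ∘ (e′ ◅_)) s′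

  kept≢swapped : (_≟_ : DecidableEquality V) → ∀ {p q p′ q′ l m u u′ r s} →
    Regraft p p′ l u u′ → Regraft q q′ m u u′ → Rooted p r → Rooted q s → p′ ≗ q′ → l ≡ m →
    ¬ Reach p u u′ × p′ u ≡ p u × l ≡ p u′ → ¬ (Reach q u u′ × q′ u ≡ q u′ × m ≡ q u)
  kept≢swapped _≟_ {l = nothing} P Q rp rq _ _ _ _ = Regrafting.label≢nothing _≟_ P rp refl
  kept≢swapped _≟_ {l = just _}  P Q rp rq p′≗q′ l≡m (n , a , b) (y , c , d) =
    Regrafting.kept-label _≟_ P rp n (sym b) a
      (reach-cong (sym ∘ p′≗q′) (Regrafting.swapped-label _≟_ Q rq y (trans (sym d) (sym l≡m))))

  regraft-values-injective : (_≟_ : DecidableEquality V) → ∀ {p q p′ q′ l m u u′ r s} →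
    Regraft p p′ l u u′ → Regraft q q′ m u u′ → Rooted p r → Rooted q s →
    p′ ≗ q′ → l ≡ m → p u ≡ q u × p u′ ≡ q u′
  regraft-values-injective _≟_ P Q rp rq p′≗q′ l≡m with Regraft.value P | Regraft.value Q
  ... | inj₁ (_ , a , b) | inj₁ (_ , c , d) =
    trans (sym a) (trans (p′≗q′ _) c) , trans (sym b) (trans l≡m d)
  ... | inj₂ (_ , a , b) | inj₂ (_ , c , d) =
    trans (sym b) (trans l≡m d) , trans (sym a) (trans (p′≗q′ _) c)
  ... | inj₁ v | inj₂ w = contradiction w (kept≢swapped _≟_ P Q rp rq p′≗q′ l≡m v)
  ... | inj₂ v | inj₁ w =
    contradiction v (kept≢swapped _≟_ Q P rq rp (sym ∘ p′≗q′) (sym l≡m) w)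

module Merging {V : Set} (_≟_ : DecidableEquality V)
               (reach? : ∀ p (x y : V) → Dec (Reach p x y)) where

  hang : (V → Maybe V) → V → V → V → Maybe V
  hang φ v u x with x ≟ v
  ... | yes _ = just u
  ... | no _  = φ x

  hang-≡ : ∀ φ v u → hang φ v u v ≡ just u
  hang-≡ φ v u with v ≟ v
  ... | yes _  = refl
  ... | no v≢v = contradiction refl v≢v

  hang-≢ : ∀ φ {v u x} → x ≢ v → hang φ v u x ≡ φ x
  hang-≢ φ {v} {x = x} x≢v with x ≟ v
  ... | yes x≡v = contradiction x≡v x≢v
  ... | no _    = refl

  hang-proper : ∀ φ {v u x} → hang φ v u x ≡ nothing → φ x ≡ nothing
  hang-proper φ {v} {x = x} eq with x ≟ v
  hang-proper φ () | yes _
  hang-proper φ eq | no _ = eq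

  exchange : (V → Maybe V) → V → V → V → Maybe V
  exchange P u v x with x ≟ u | x ≟ v
  ... | yes _ | _     = P v
  ... | no _  | yes _ = P u
  ... | no _  | no _  = P x

  exchangeˡ : ∀ P u v → exchange P u v u ≡ P v
  exchangeˡ P u v with u ≟ u | u ≟ v
  ... | yes _  | _ = refl
  ... | no u≢u | _ = contradiction refl u≢u

  exchangeʳ : ∀ P u v → exchange P u v v ≡ P u
  exchangeʳ P u v with v ≟ u | v ≟ v
  ... | yes refl | _      = refl
  ... | no _     | yes _  = refl
  ... | no _     | no v≢v = contradiction refl v≢v

  exchange-≢ : ∀ P {u v x} → x ≢ u → x ≢ v → exchange P u v x ≡ P x
  exchange-≢ P {u} {v} {x} x≢u x≢v with x ≟ u | x ≟ v
  ... | yes x≡u | _       = contradiction x≡u x≢u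
  ... | no _    | yes x≡v = contradiction x≡v x≢v
  ... | no _    | no _    = refl

  -- φ overrides P: the vertices that have been hung onto others follow φ,
  -- while P keeps the labels that were set aside at them.
  attach : (V → Maybe V) → (V → Maybe V) → V → Maybe V
  attach φ P x = φ x <∣> P x

  <∣>-nothing : ∀ {m n : Maybe V} → m ≡ nothing → (m <∣> n) ≡ n
  <∣>-nothing refl = refl

  <∣>-nothing⁻ : ∀ {m n : Maybe V} → (m <∣> n) ≡ nothing → m ≡ nothing
  <∣>-nothing⁻ {nothing} _ = refl

  <∣>-just : ∀ {m n : Maybe V} {y} → m ≡ just y → (m <∣> n) ≡ just y
  <∣>-just refl = refl

  merge : (V → Maybe V) → (V → Maybe V) → V → V → V → Maybe V
  merge φ P u v with reach? (attach φ P) u v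
  ... | yes _ = exchange P u v
  ... | no _  = P

  merge-≢ : ∀ φ P {u v x} → x ≢ u → x ≢ v → merge φ P u v x ≡ P x
  merge-≢ φ P {u} {v} x≢u x≢v with reach? (attach φ P) u v
  ... | yes _ = exchange-≢ P x≢u x≢v
  ... | no _  = refl

  merge-value : ∀ φ P u v → (¬ Reach (attach φ P) u v × merge φ P u v ≡ P)
                          ⊎ (  Reach (attach φ P) u v × merge φ P u v ≡ exchange P u v)
  merge-value φ P u v with reach? (attach φ P) u v
  ... | yes u↝v = inj₂ (u↝v , refl)
  ... | no u↝̸v  = inj₁ (u↝̸v , refl)

  merge-regraft : ∀ {φ} P {u v} → u ≢ v → φ u ≡ nothing → φ v ≡ nothing →
                  Regraft (attach φ P) (attach (hang φ v u) (merge φ P u v)) (merge φ P u v v) u v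
  merge-regraft {φ} P {u} {v} u≢v φu φv = record
    { u≢u′  = u≢v
    ; hung  = <∣>-just (hang-≡ φ v u)
    ; agree = λ {x} x≢u x≢v →
        cong₂ _<∣>_ (hang-≢ φ x≢v) (merge-≢ φ P x≢u x≢v)
    ; value = value
    }
    where
    at-u : ∀ {m} → (hang φ v u u <∣> m) ≡ m
    at-u = <∣>-nothing (trans (hang-≢ φ u≢v) φu)

    value : (¬ Reach (attach φ P) u v
               × attach (hang φ v u) (merge φ P u v) u ≡ attach φ P u
               × merge φ P u v v ≡ attach φ P v)
          ⊎ (Reach (attach φ P) u v
               × attach (hang φ v u) (merge φ P u v) u ≡ attach φ P v
               × merge φ P u v v ≡ attach φ P u)
    value with merge-value φ P u v
    ... | inj₁ (u↝̸v , eq) = inj₁ (u↝̸v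
      , trans at-u (trans (cong-app eq u) (sym (<∣>-nothing φu)))
      , trans (cong-app eq v) (sym (<∣>-nothing φv)))
    ... | inj₂ (u↝v , eq) = inj₂ (u↝v
      , trans at-u (trans (cong-app eq u) (trans (exchangeˡ P u v) (sym (<∣>-nothing φv))))
      , trans (cong-app eq v) (trans (exchangeʳ P u v) (sym (<∣>-nothing φu))))

  module _ (h : V → V) where

    run : (V → Maybe V) → (V → Maybe V) → List V → V → Maybe V
    run φ P []       = P
    run φ P (v ∷ vs) = run (hang φ v (h v)) (merge φ P (h v) v) vs

    freeze : (V → Maybe V) → List V → V → Maybe V
    freeze φ []       = φ
    freeze φ (v ∷ vs) = freeze (hang φ v (h v)) vs

    Mergeable : (V → Maybe V) → List V → Set
    Mergeable φ vs = Unique vs × (∀ {v} → v ∈ vs → φ v ≡ nothing × φ (h v) ≡ nothing × h v ∉ vs)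

    mergeable-tail : ∀ {φ v vs} → Mergeable φ (v ∷ vs) → Mergeable (hang φ v (h v)) vs
    mergeable-tail {φ} (v≢ ∷ u , free) = u , λ w∈ →
      let φw , φhw , hw∉ = free (there w∈) in
      trans (hang-≢ φ (λ { refl → All.lookup v≢ w∈ refl })) φw ,
      trans (hang-≢ φ (hw∉ ∘ here)) φhw , hw∉ ∘ there

    mergeable-head : ∀ {φ v vs} P → Mergeable φ (v ∷ vs) →
      Regraft (attach φ P) (attach (hang φ v (h v)) (merge φ P (h v) v)) (merge φ P (h v) v v) (h v) v
    mergeable-head P (_ , free) =
      let φv , φhv , hv∉ = free (here refl) in merge-regraft P (hv∉ ∘ here) φhv φv

    run-rooted : ∀ {φ} P vs → Mergeable φ vs → ∃ (Rooted (attach φ P)) →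
                 ∃ (Rooted (attach (freeze φ vs) (run φ P vs)))
    run-rooted P []       m r       = r
    run-rooted P (v ∷ vs) m (_ , r) =
      run-rooted _ vs (mergeable-tail m) (Regrafting.regraft-rooted _≟_ (mergeable-head P m) r)

    run-injective : ∀ {φ} P Q vs → Mergeable φ vs →
                    ∃ (Rooted (attach φ P)) → ∃ (Rooted (attach φ Q)) →
                    run φ P vs ≗ run φ Q vs → P ≗ Q
    run-injective P Q [] m _ _ eq = eq
    run-injective {φ} P Q (v ∷ vs) m@(_ , free) (_ , rp) (_ , rq) eq = P≗Q
      where
      eq′ : merge φ P (h v) v ≗ merge φ Q (h v) v
      eq′ = run-injective _ _ vs (mergeable-tail m)
        (Regrafting.regraft-rooted _≟_ (mergeable-head P m) rp)
        (Regrafting.regraft-rooted _≟_ (mergeable-head Q m) rq) eq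

      values : attach φ P (h v) ≡ attach φ Q (h v) × attach φ P v ≡ attach φ Q v
      values = regraft-values-injective _≟_ (mergeable-head P m) (mergeable-head Q m) rp rq
        (λ x → cong (hang φ v (h v) x <∣>_) (eq′ x)) (eq′ v)

      free-values : ∀ {x} → φ x ≡ nothing → attach φ P x ≡ attach φ Q x → P x ≡ Q x
      free-values φx e = trans (sym (<∣>-nothing φx)) (trans e (<∣>-nothing φx))

      P≗Q : P ≗ Q
      P≗Q x with x ≟ h v | x ≟ v
      ... | yes refl | _        = free-values (proj₁ (proj₂ (free (here refl)))) (proj₁ values)
      ... | no _     | yes refl = free-values (proj₁ (free (here refl))) (proj₂ values)
      ... | no x≢u   | no x≢v   =
        trans (sym (merge-≢ φ P x≢u x≢v)) (trans (eq′ x) (merge-≢ φ Q x≢u x≢v))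

    run-fixed : ∀ φ P vs {x} → x ∉ vs → (∀ {v} → v ∈ vs → x ≢ h v) → run φ P vs x ≡ P x
    run-fixed φ P []       x∉ x≢ = refl
    run-fixed φ P (v ∷ vs) x∉ x≢ =
      trans (run-fixed _ _ vs (x∉ ∘ there) (x≢ ∘ there))
            (merge-≢ φ P (x≢ (here refl)) (x∉ ∘ here))

    freeze-proper : ∀ φ vs {x} → freeze φ vs x ≡ nothing → φ x ≡ nothing
    freeze-proper φ []       eq = eq
    freeze-proper φ (v ∷ vs) eq = hang-proper φ (freeze-proper _ vs eq)

    freeze-∈ : ∀ φ vs {x} → x ∈ vs → freeze φ vs x ≢ nothing
    freeze-∈ φ (v ∷ vs) (here refl) eq =
      nothing≢just (freeze-proper _ vs eq) (hang-≡ φ v (h v))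
    freeze-∈ φ (v ∷ vs) (there x∈) eq = freeze-∈ _ vs x∈ eq

    freeze-∉ : ∀ φ vs {x} → x ∉ vs → freeze φ vs x ≡ φ x
    freeze-∉ φ []       x∉ = refl
    freeze-∉ φ (v ∷ vs) x∉ = trans (freeze-∉ _ vs (x∉ ∘ there)) (hang-≢ φ (x∉ ∘ here))

    run-label : ∀ φ P vs → Mergeable φ vs → ∃ (Rooted (attach φ P)) →
                ∀ {v} → v ∈ vs → run φ P vs v ≢ nothing
    run-label φ P (w ∷ vs) m@(w≢ ∷ _ , free) (_ , r) {v} (here refl) eq =
      Regrafting.label≢nothing _≟_ (mergeable-head P m) r
        (trans (sym (run-fixed _ _ vs (λ w∈ → All.lookup w≢ w∈ refl)
                      (λ { w∈ refl → proj₂ (proj₂ (free (there w∈))) (here refl) }))) eq)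
    run-label φ P (w ∷ vs) m (_ , r) (there v∈) =
      run-label _ _ vs (mergeable-tail m) (Regrafting.regraft-rooted _≟_ (mergeable-head P m) r) v∈

    run-invariant : (Q : V → Maybe V → Set) → ∀ φ P vs →
                    (∀ {v} → v ∈ vs → ∀ {m} → (Q (h v) m → Q v m) × (Q v m → Q (h v) m)) →
                    (∀ x → Q x (P x)) → ∀ x → Q x (run φ P vs x)
    run-invariant Q φ P []       equi inv = inv
    run-invariant Q φ P (v ∷ vs) equi inv = run-invariant Q _ _ vs (equi ∘ there) inv′
      where
      inv′ : ∀ x → Q x (merge φ P (h v) v x)
      inv′ x with reach? (attach φ P) (h v) v
      ... | no _ = inv x
      ... | yes _ with x ≟ h v | x ≟ v
      ...   | yes refl | _        = proj₂ (equi (here refl)) (inv v)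
      ...   | no _     | yes refl = proj₁ (equi (here refl)) (inv (h v))
      ...   | no _     | no _     = inv x

-- Spanning trees as parent functions

least : ∀ {P : ℕ → Set} → U.Decidable P → ∀ n → P n → ∃ λ k → P k × ∀ {j} → P j → k ≤ j
least P? zero pn = zero , pn , λ _ → z≤n
least {P} P? (suc n) pn with P? zero
... | yes p0 = zero , p0 , λ _ → z≤n
... | no ¬p0 with least (P? ∘ suc) n pn
...   | k , pk , min = suc k , pk , suc-min
  where
  suc-min : ∀ {j} → P j → suc k ≤ j
  suc-min {zero}  p0 = contradiction p0 ¬p0
  suc-min {suc j} pj = s≤s (min pj)

module _ {A : Set} where

  data Path (R : Rel A 0ℓ) (y : A) : A → List A → Set where
    stop : Path R y y (y ∷ [])
    step : ∀ {x z zs} → R x z → Path R y z zs → Path R y x (x ∷ zs)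

  suffix : ∀ {R : Rel A 0ℓ} {x y z zs} → Path R y z zs → Unique zs → x ∈ zs →
           ∃ λ xs → Path R y x xs × Unique xs
  suffix stop       u       (here refl) = _ , stop , u
  suffix p@(step _ _) u     (here refl) = _ , p , u
  suffix (step _ p) (_ ∷ u) (there x∈)  = suffix p u x∈

  star⇒path : DecidableEquality A → ∀ {R : Rel A 0ℓ} {x y} → Star R x y →
              ∃ λ xs → Path R y x xs × Unique xs
  star⇒path _≟_ ε = _ , stop , [] ∷ []
  star⇒path _≟_ {x = x} (r ◅ s) with star⇒path _≟_ s
  ... | zs , p , u with DecMembership._∈?_ _≟_ x zs
  ...   | yes x∈ = suffix p u x∈
  ...   | no x∉  = _ , step r p , All.¬Any⇒All¬ zs x∉ ∷ u

  path⇒linked : ∀ {R S : Rel A 0ℓ} {x y z zs} → (∀ {a b} → R a b → S a b) → S y x →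
                Path R y z zs → Linked S (zs ++ x ∷ [])
  path⇒linked R⊆S yx stop                  = yx ∷ [-]
  path⇒linked R⊆S yx (step r stop)         = R⊆S r ∷ yx ∷ [-]
  path⇒linked R⊆S yx (step r p@(step _ _)) = R⊆S r ∷ path⇒linked R⊆S yx p

  cycle-through : ∀ {R S : Rel A 0ℓ} {x y zs} → (∀ {a b} → R a b → S a b) → S y x →
                  x ≢ y → ¬ R x y → Path R y x zs → Unique zs → ∃ (IsCycle S)
  cycle-through R⊆S yx x≢y ¬xy stop            u = contradiction refl x≢y
  cycle-through R⊆S yx x≢y ¬xy (step r stop)   u = contradiction r ¬xy
  cycle-through R⊆S yx x≢y ¬xy p@(step _ (step _ stop)) u = _ , cycle u (path⇒linked R⊆S yx p)
  cycle-through R⊆S yx x≢y ¬xy p@(step _ (step _ (step _ _))) u = _ , cycle u (path⇒linked R⊆S yx p)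

module _ (G : FiniteGraph) where
  open FiniteGraph G hiding (vertices; order; degree)

  _≟ₘ_ : DecidableEquality (Maybe V)
  _≟ₘ_ = Maybe.≡-dec _≟_

  reach? : ∀ p x y → Dec (Reach {V} p x y)
  reach? p x y = map′ (via⇒star G arc? (vertices G)) (star⇒via G arc?)
                      (via? G arc? (vertices G) x y)
    where
    arc? : ∀ x y → Dec (Arc p x y)
    arc? x y = p x ≟ₘ just y

  module _ {T : List (V × V)} (r : V) where

    private
      _⌢_ = Joined T

    Walk : ℕ → V → Set
    Walk zero    x = x ≡ r
    Walk (suc k) x = ∃ λ z → x ⌢ z × Walk k z

    walk? : ∀ k x → Dec (Walk k x)
    walk? zero    x = x ≟ r
    walk? (suc k) x = ∃? G λ z → joined? G T x z ×-dec walk? k z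

    star⇒walk : ∀ {x} → Star _⌢_ x r → ∃ λ k → Walk k x
    star⇒walk ε       = zero , refl
    star⇒walk (e ◅ s) = let k , w = star⇒walk s in suc k , _ , e , w

    IsParent : (V → Maybe V) → Set
    IsParent p = Rooted p r × (∀ {x y} → Arc p x y → x ⌢ y)

    -- Breadth-first: every vertex other than r points to a neighbour nearer to r.
    parents : Connected _⌢_ → ∃ IsParent
    parents conn = parent , (root , λ x → reaches _ x ℕ.≤-refl) , arc
      where
      nearest : ∀ x → ∃ λ k → Walk k x × ∀ {j} → Walk j x → k ≤ j
      nearest x = let n , w = star⇒walk (conn x r) in least (λ k → walk? k x) n w

      parent : V → Maybe V
      parent x with nearest x
      ... | zero  , _           , _ = nothing
      ... | suc _ , (z , _ , _) , _ = just z

      root : parent r ≡ nothing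
      root with nearest r
      ... | zero  , _ , _   = refl
      ... | suc k , _ , min with min {zero} refl
      ...   | ()

      arc : ∀ {x y} → Arc parent x y → x ⌢ y
      arc {x} e with nearest x
      arc {x} refl | suc _ , (z , xz , _) , _ = xz

      reaches : ∀ d x → proj₁ (nearest x) ≤ d → Reach parent x r
      reaches d x ≤d with nearest x in eq
      ... | zero , refl , _ = ε
      reaches (suc d) x (s≤s ≤d) | suc k , (z , xz , w) , min =
        parent-x ◅ reaches d z (ℕ.≤-trans (proj₂ (proj₂ (nearest z)) w) ≤d)
        where
        parent-x : parent x ≡ just z
        parent-x rewrite eq = refl

  parents-cover : ∀ {T r p} → Acyclic (Joined T) → IsParent {T} r p →
                  ∀ {x y} → x ≢ y → Joined T x y → Arc p x y ⊎ Arc p y x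
  parents-cover {T} {r} {p} acyclic ((_ , reach) , arc) {x} {y} x≢y e
    with p x ≟ₘ just y | p y ≟ₘ just x
  ... | yes a | _     = inj₁ a
  ... | no _  | yes b = inj₂ b
  ... | no ¬a | no ¬b = contradiction (cycle-of (star⇒path _≟_ walk)) acyclic
    where
    R : Rel V 0ℓ
    R a b = Arc p a b ⊎ Arc p b a

    walk : Star R x y
    walk = Star.map inj₁ (reach x) ◅◅ Star.reverse swap (Star.map inj₁ (reach y))

    cycle-of : (∃ λ xs → Path R y x xs × Unique xs) → ∃ (IsCycle (Joined T))
    cycle-of (_ , path , u) =
      cycle-through [ arc , swap ∘ arc ]′ (swap e) x≢y [ ¬a , ¬b ]′ path u

  edges-asym : ∀ {a b} → (a , b) ∈ edges G → (b , a) ∉ edges G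
  edges-asym p q = pairs-asym unique (proj₁ (∈-filter⁻ (λ (x , y) → x ~? y) p))
                                     (proj₁ (∈-filter⁻ (λ (x , y) → x ~? y) q))

  edges-adjacent : ∀ {a b} → (a , b) ∈ edges G → a ~ b
  edges-adjacent p = proj₂ (∈-filter⁻ (λ (x , y) → x ~? y) {xs = pairs (vertices G)} p)

  edges-unique : Unique (edges G)
  edges-unique = Unique.filter⁺ _ (pairs-unique unique)

  joined⇒adjacent : ∀ {T} → T ∈ sublists (edges G) → ∀ {x y} → Joined T x y → x ~ y
  joined⇒adjacent T∈ (inj₁ e) = edges-adjacent (∈-sublists⁻ T∈ e)
  joined⇒adjacent T∈ (inj₂ e) = ~-sym (edges-adjacent (∈-sublists⁻ T∈ e))

  ~⇒≢ : ∀ {x y} → x ~ y → x ≢ y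
  ~⇒≢ a refl = ~-irrefl a

  spanningTrees : List (List (V × V))
  spanningTrees = filter (λ F → isTree? G (joined? G F)) (sublists (edges G))

  ∈-spanningTrees⁻ : ∀ {T} → T ∈ spanningTrees → T ∈ sublists (edges G) × IsTree (Joined T)
  ∈-spanningTrees⁻ = ∈-filter⁻ (λ F → isTree? G (joined? G F))

  parents-determine : ∀ {T U r s p q} → T ∈ spanningTrees → U ∈ spanningTrees →
                      IsParent {T} r p → IsParent {U} s q → (∀ x → p x ≡ q x) → T ≡ U × r ≡ s
  parents-determine {T} {U} T∈ U∈ P@((pr , _) , _) Q@(root-q , _) p≗q =
    sublists-ext edges-unique (proj₁ (∈-spanningTrees⁻ T∈)) (proj₁ (∈-spanningTrees⁻ U∈))
      (within T∈ U∈ P Q p≗q) (within U∈ T∈ Q P (sym ∘ p≗q)) ,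
    root-unique root-q (trans (sym (p≗q _)) pr)
    where
    within : ∀ {T U r s p q} → T ∈ spanningTrees → U ∈ spanningTrees →
             IsParent {T} r p → IsParent {U} s q → (∀ x → p x ≡ q x) →
             ∀ {e} → e ∈ T → e ∈ U
    within {T} {U} {p = p} T∈ U∈ P (_ , arc) p≗q {a , b} e =
      orient ([ transfer , swap ∘ transfer ]′
        (parents-cover acyclic P (~⇒≢ (joined⇒adjacent T⊆ (inj₁ e))) (inj₁ e)))
      where
      T⊆ = proj₁ (∈-spanningTrees⁻ T∈)
      U⊆ = proj₁ (∈-spanningTrees⁻ U∈)
      acyclic = proj₂ (proj₂ (∈-spanningTrees⁻ T∈))

      transfer : ∀ {x y} → Arc p x y → Joined U x y
      transfer a = arc (trans (sym (p≗q _)) a)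

      orient : Joined U a b → (a , b) ∈ U
      orient (inj₁ e′) = e′
      orient (inj₂ e′) = contradiction (∈-sublists⁻ U⊆ e′) (edges-asym (∈-sublists⁻ T⊆ e))

  spanningTrees-unique : Unique spanningTrees
  spanningTrees-unique = Unique.filter⁺ _ (sublists-unique edges-unique)

-- Coding spanning trees of a join

pick : ∀ {A : Set} {P : A → Set} → U.Decidable P → A → List A → A
pick P? d []       = d
pick P? d (x ∷ xs) with P? x
... | yes _ = x
... | no _  = pick P? d xs

pick-satisfies : ∀ {A : Set} {P : A → Set} (P? : U.Decidable P) {d x} xs → x ∈ xs → P x →
                 P (pick P? d xs)
pick-satisfies P? (y ∷ xs) x∈ px with P? y
... | yes py = py
pick-satisfies P? (y ∷ xs) (here refl) px | no ¬py = contradiction px ¬py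
pick-satisfies P? (y ∷ xs) (there x∈)  px | no _   = pick-satisfies P? xs x∈ px

module JoinCode {m : ℕ} (G : FiniteGraph) (block : FiniteGraph.V G → Fin (suc m))
                (across : ∀ {x y} → block x ≢ block y → FiniteGraph._~_ G x y)
                (inhabited : ∀ i → ∃ λ x → block x ≡ i) where

  open FiniteGraph G hiding (vertices; order; degree)
  open Merging _≟_ (reach? G)

  vs : List V
  vs = vertices G

  at-position : ∀ x → lookup vs (position x) ≡ x
  at-position x = sym (lookup-index (complete x))

  crossing : Fin (suc m) → Maybe V → Bool
  crossing i nothing  = true
  crossing i (just y) = not (does (block y Fin.≟ i))

  crossing⇒≢ : ∀ {i y} → crossing i (just y) ≡ true → block y ≢ i
  crossing⇒≢ {i} {y} c eq with block y Fin.≟ i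
  crossing⇒≢ () eq | yes _
  ... | no ≢ = ≢ eq

  ≢⇒crossing : ∀ {i y} → block y ≢ i → crossing i (just y) ≡ true
  ≢⇒crossing {i} {y} ≢ = cong not (dec-false (block y Fin.≟ i) ≢)

  ¬crossing⇒≡ : ∀ {i y} → crossing i (just y) ≡ false → block y ≡ i
  ¬crossing⇒≡ {i} {y} c with block y Fin.≟ i
  ... | yes eq = eq
  ¬crossing⇒≡ () | no _

  -- A vector rather than a function, so that equal codes have propositionally
  -- equal crossings.
  crossings : (V → Maybe V) → Vec Bool (order G)
  crossings p = Vec.tabulate λ k → let x = lookup vs k in crossing (block x) (p x)

  module _ (K : Vec Bool (order G)) where

    κ : V → Bool
    κ x = Vec.lookup K (position x)

    Candidate : Fin (suc m) → V → Set
    Candidate i x = κ x ≡ true × block x ≡ i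

    candidate? : ∀ i → U.Decidable (Candidate i)
    candidate? i x = (κ x Bool.≟ true) ×-dec (block x Fin.≟ i)

    rep : Fin (suc m) → V
    rep i = pick (candidate? i) (proj₁ (inhabited i)) vs

    -- Stage 1 merges the crossing vertices of each block into its
    -- representative, stage 2 the representatives into the first one.
    hook₁ hook₂ : V → V
    hook₁ x = rep (block x)
    hook₂ _ = rep zero

    Merged₁ : V → Set
    Merged₁ x = κ x ≡ true × x ≢ rep (block x)

    merged₁? : U.Decidable Merged₁
    merged₁? x = (κ x Bool.≟ true) ×-dec ¬? (x ≟ rep (block x))

    merged₁ merged₂ : List V
    merged₁ = filter merged₁? vs
    merged₂ = tabulate (rep ∘ suc)

    φ₀ φ₁ φ₂ : V → Maybe V
    φ₀ _ = nothing
    φ₁   = freeze hook₁ φ₀ merged₁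
    φ₂   = freeze hook₂ φ₁ merged₂

    stage₁ stage₂ : (V → Maybe V) → V → Maybe V
    stage₁ p = run hook₁ φ₀ p merged₁
    stage₂ p = run hook₂ φ₁ (stage₁ p) merged₂

    -- The values of stage₂ at the representatives are recorded separately (see
    -- `tops`), which leaves room for w.
    code : (V → Maybe V) → Vec V (suc m) → V → Maybe V
    code p w x with x ≟ rep (block x)
    ... | yes _ = just (Vec.lookup w (block x))
    ... | no _  = stage₂ p x

  module Coding {T r p} (parent : IsParent G {T} r p) where

    private
      K = crossings p
      root = proj₁ parent

    κ-crossing : ∀ x → κ K x ≡ crossing (block x) (p x)
    κ-crossing x = trans (Vec.lookup∘tabulate _ (position x))
                         (cong (λ y → crossing (block y) (p y)) (at-position x))

    exit : ∀ {x} → Reach p x r → ∃ λ y → Candidate K (block x) y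
    exit ε = r , trans (κ-crossing r) (cong (crossing _) (proj₁ root)) , refl
    exit {x} (_◅_ {j = z} e s) with κ K x in κx
    ... | true  = x , κx , refl
    ... | false with exit s
    ...   | y , κy , y≡z = y , κy , trans y≡z (¬crossing⇒≡
      (trans (cong (crossing (block x)) (sym e)) (trans (sym (κ-crossing x)) κx)))

    rep-candidate : ∀ i → Candidate K i (rep K i)
    rep-candidate i =
      let x , x∈i = inhabited i
          y , κy , y∈x = exit (proj₂ root x)
      in pick-satisfies (candidate? K i) vs (complete y) (κy , trans y∈x x∈i)

    rep-block : ∀ i → block (rep K i) ≡ i
    rep-block i = proj₂ (rep-candidate i)

    rep-injective : ∀ {i j} → rep K i ≡ rep K j → i ≡ j
    rep-injective {i} {j} eq = trans (sym (rep-block i)) (trans (cong block eq) (rep-block j))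

    rep-hook : ∀ i → rep K i ≡ rep K (block (rep K i))
    rep-hook i = cong (rep K) (sym (rep-block i))

    rep∉merged₁ : ∀ i → rep K i ∉ merged₁ K
    rep∉merged₁ i ∈m = proj₂ (proj₂ (∈-filter⁻ (merged₁? K) {xs = vs} ∈m)) (rep-hook i)

    φ₁-rep : ∀ i → φ₁ K (rep K i) ≡ nothing
    φ₁-rep i = freeze-∉ (hook₁ K) _ (merged₁ K) (rep∉merged₁ i)

    mergeable₁ : Mergeable (hook₁ K) (φ₀ K) (merged₁ K)
    mergeable₁ = Unique.filter⁺ (merged₁? K) unique , λ {v} _ → refl , refl , rep∉merged₁ (block v)

    mergeable₂ : Mergeable (hook₂ K) (φ₁ K) (merged₂ K)
    mergeable₂ = Unique.tabulate⁺ (Fin.suc-injective ∘ rep-injective) , free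
      where
      free : ∀ {v} → v ∈ merged₂ K →
             φ₁ K v ≡ nothing × φ₁ K (rep K zero) ≡ nothing × rep K zero ∉ merged₂ K
      free v∈ with ∈-tabulate⁻ v∈
      ... | i , refl = φ₁-rep (suc i) , φ₁-rep zero ,
        λ 0∈ → let j , eq = ∈-tabulate⁻ 0∈ in Fin.0≢1+n (rep-injective eq)

    rooted₁ : ∃ (Rooted (attach (φ₁ K) (stage₁ K p)))
    rooted₁ = run-rooted (hook₁ K) p (merged₁ K) mergeable₁ (r , root)

    rooted₂ : ∃ (Rooted (attach (φ₂ K) (stage₂ K p)))
    rooted₂ = run-rooted (hook₂ K) (stage₁ K p) (merged₂ K) mergeable₂ rooted₁

    Invariant : V → Maybe V → Set
    Invariant x y = (κ K x ≡ true → crossing (block x) y ≡ true) × (κ K x ≡ false → y ≡ p x)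

    stage₁-invariant : ∀ x → Invariant x (stage₁ K p x)
    stage₁-invariant = run-invariant (hook₁ K) Invariant (φ₀ K) p (merged₁ K) equi
      λ x → (λ κx → trans (sym (κ-crossing x)) κx) , λ _ → refl
      where
      equi : ∀ {v} → v ∈ merged₁ K → ∀ {y} →
             (Invariant (hook₁ K v) y → Invariant v y) × (Invariant v y → Invariant (hook₁ K v) y)
      equi {v} v∈ {y} =
        (λ inv → (λ _ → subst (λ i → crossing i y ≡ true) (rep-block (block v)) (proj₁ inv κ-rep))
               , λ κv → contradiction (trans (sym κv′) κv) λ ()) ,
        (λ inv → (λ _ → subst (λ i → crossing i y ≡ true) (sym (rep-block (block v))) (proj₁ inv κv′))
               , λ κv → contradiction (trans (sym κ-rep) κv) λ ())
        where
        κ-rep = proj₁ (rep-candidate (block v))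
        κv′ = proj₁ (proj₂ (∈-filter⁻ (merged₁? K) {xs = vs} v∈))

    stage₂-fixed : ∀ {x} → x ≢ rep K (block x) → stage₂ K p x ≡ stage₁ K p x
    stage₂-fixed {x} x≢ = run-fixed (hook₂ K) (φ₁ K) (stage₁ K p) (merged₂ K)
      (λ x∈ → let _ , eq = ∈-tabulate⁻ x∈ in x≢rep _ eq) (λ _ → x≢rep zero)
      where
      x≢rep : ∀ i → x ≢ rep K i
      x≢rep i refl = x≢ (rep-hook i)

    inside-value : ∀ x → κ K x ≡ false → p x ≢ nothing
    inside-value x κx px =
      contradiction (trans (sym κx) (trans (κ-crossing x) (cong (crossing (block x)) px))) λ ()

    stage₁-label : ∀ {x} → x ∈ merged₁ K → stage₁ K p x ≢ nothing
    stage₁-label = run-label (hook₁ K) (φ₀ K) p (merged₁ K) mergeable₁ (r , root)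

    stage₂-label : ∀ i → stage₂ K p (rep K (suc i)) ≢ nothing
    stage₂-label i =
      run-label (hook₂ K) (φ₁ K) (stage₁ K p) (merged₂ K) mergeable₂ rooted₁ (∈-tabulate⁺ i)

    inside≢rep : ∀ {x} → κ K x ≡ false → x ≢ rep K (block x)
    inside≢rep {x} κx x≡ =
      contradiction (trans (sym (proj₁ (rep-candidate (block x)))) (trans (cong (κ K) (sym x≡)) κx)) λ ()

    stage₂-root : stage₂ K p (rep K zero) ≡ nothing
    stage₂-root with rooted₂
    ... | s , s-root , _ = subst (λ x → stage₂ K p x ≡ nothing) (is-rep (κ K s) refl) value
      where
      φ₂s : φ₂ K s ≡ nothing
      φ₂s = <∣>-nothing⁻ s-root

      value : stage₂ K p s ≡ nothing
      value = trans (sym (<∣>-nothing φ₂s)) s-root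

      is-rep : ∀ b → κ K s ≡ b → s ≡ rep K zero
      is-rep false κs = contradiction
        (trans (sym (proj₂ (stage₁-invariant s) κs))
               (trans (sym (stage₂-fixed (inside≢rep κs))) value))
        (inside-value s κs)
      is-rep true κs with s ≟ rep K (block s)
      ... | no s≢ = contradiction (freeze-proper (hook₂ K) _ (merged₂ K) φ₂s)
        (freeze-∈ (hook₁ K) _ (merged₁ K) (∈-filter⁺ (merged₁? K) (complete s) (κs , s≢)))
      ... | yes s≡ with block s
      ...   | zero  = s≡
      ...   | suc i = contradiction φ₂s
        (freeze-∈ (hook₂ K) _ (merged₂ K) (subst (_∈ merged₂ K) (sym s≡) (∈-tabulate⁺ i)))

    module _ {w : Vec V (suc m)} (outside : ∀ i → block (Vec.lookup w i) ≢ i) where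

      code-crossing : ∀ x → crossing (block x) (code K p w x) ≡ crossing (block x) (p x)
      code-crossing x = trans (κ-code (κ K x) refl) (κ-crossing x)
        where
        κ-code : ∀ b → κ K x ≡ b → crossing (block x) (code K p w x) ≡ κ K x
        κ-code b κx with x ≟ rep K (block x)
        ... | yes x≡ = trans (≢⇒crossing (outside (block x)))
                             (sym (trans (cong (κ K) x≡) (proj₁ (rep-candidate (block x)))))
        κ-code true κx | no x≢ = trans
          (cong (crossing (block x)) (stage₂-fixed x≢))
          (trans (proj₁ (stage₁-invariant x) κx) (sym κx))
        κ-code false κx | no x≢ = trans
          (cong (crossing (block x)) (trans (stage₂-fixed x≢) (proj₂ (stage₁-invariant x) κx)))
          (sym (κ-crossing x))

      code-adjacent : (∀ {x y} → Arc p x y → x ~ y) → ∀ x → code K p w x ∈ map just (filter (x ~?_) vs)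
      code-adjacent p⊆~ x = go (κ K x) refl
        where
        Neighbour : Maybe V → Set
        Neighbour v = v ∈ map just (filter (x ~?_) vs)

        neighbour : ∀ {y} → x ~ y → Neighbour (just y)
        neighbour {y} x~y = ∈-map⁺ just (∈-filter⁺ (x ~?_) (complete y) x~y)

        inward : ∀ {v} → p x ≡ v → v ≢ nothing → Neighbour v
        inward {just _}  e _  = neighbour (p⊆~ e)
        inward {nothing} _ v≢ = contradiction refl v≢

        outward : ∀ {v} → crossing (block x) v ≡ true → v ≢ nothing → Neighbour v
        outward {just _}  c _  = neighbour (across (crossing⇒≢ c ∘ sym))
        outward {nothing} _ v≢ = contradiction refl v≢

        go : ∀ b → κ K x ≡ b → Neighbour (code K p w x)
        go b κx with x ≟ rep K (block x)
        ... | yes _ = neighbour (across (outside (block x) ∘ sym))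
        go true κx | no x≢ = subst Neighbour (sym (stage₂-fixed x≢))
          (outward (proj₁ (stage₁-invariant x) κx)
                   (stage₁-label (∈-filter⁺ (merged₁? K) (complete x) (κx , x≢))))
        go false κx | no x≢ =
          subst Neighbour (sym (trans (stage₂-fixed x≢) (proj₂ (stage₁-invariant x) κx)))
            (inward refl (inside-value x κx))

  record Encodes (source : V × List (V × V) × Vec V (suc m))
                 (target : Vec (Maybe V) (order G) × Vec (Maybe V) m) : Set where
    field
      p       : V → Maybe V
      tree    : proj₁ (proj₂ source) ∈ spanningTrees G
      parent  : IsParent G {proj₁ (proj₂ source)} (proj₁ source) p
      outside : ∀ i → block (Vec.lookup (proj₂ (proj₂ source)) i) ≢ i
      values  : proj₁ target ≡ Vec.tabulate (code (crossings p) p (proj₂ (proj₂ source)) ∘ lookup vs)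
      tops    : proj₂ target ≡ Vec.tabulate (stage₂ (crossings p) p ∘ rep (crossings p) ∘ suc)

  stage₂-determined : ∀ {T U r s p q w} (P : IsParent G {T} r p) (Q : IsParent G {U} s q) →
    (K : Vec Bool (order G)) → K ≡ crossings p → K ≡ crossings q → ∀ {w′} →
    code K p w ≗ code K q w′ →
    (∀ i → stage₂ K p (rep K (suc i)) ≡ stage₂ K q (rep K (suc i))) →
    p ≗ q × (∀ i → Vec.lookup w i ≡ Vec.lookup w′ i)
  stage₂-determined {p = p} {q} {w} P Q K refl K≡ {w′} code≗ tops≡ =
    run-injective (hook₁ K) p q (merged₁ K) P.mergeable₁ (_ , proj₁ P) (_ , proj₁ Q)
      (run-injective (hook₂ K) (stage₁ K p) (stage₁ K q) (merged₂ K) P.mergeable₂ P.rooted₁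
        (subst (λ K → ∃ (Rooted (attach (φ₁ K) (stage₁ K q)))) (sym K≡) Q.rooted₁) stage₂≗) ,
    λ i → Maybe.just-injective (trans (sym (code-rep p w i)) (trans (code≗ _) (code-rep q w′ i)))
    where
    module P = Coding P
    module Q = Coding Q

    code-rep : ∀ p w i → code K p w (rep K i) ≡ just (Vec.lookup w i)
    code-rep p w i with rep K i ≟ rep K (block (rep K i))
    ... | yes _ = cong (just ∘ Vec.lookup w) (P.rep-block i)
    ... | no ≢  = contradiction (P.rep-hook i) ≢

    code-other : ∀ p w {x} → x ≢ rep K (block x) → code K p w x ≡ stage₂ K p x
    code-other p w {x} x≢ with x ≟ rep K (block x)
    ... | yes x≡ = contradiction x≡ x≢
    ... | no _   = refl

    stage₂-rep : ∀ i → stage₂ K p (rep K i) ≡ stage₂ K q (rep K i)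
    stage₂-rep (suc i) = tops≡ i
    stage₂-rep zero    = trans P.stage₂-root
      (sym (subst (λ K → stage₂ K q (rep K zero) ≡ nothing) (sym K≡) Q.stage₂-root))

    stage₂≗ : stage₂ K p ≗ stage₂ K q
    stage₂≗ x with x ≟ rep K (block x)
    ... | yes x≡ = subst (λ y → stage₂ K p y ≡ stage₂ K q y) (sym x≡) (stage₂-rep (block x))
    ... | no x≢  = trans (sym (code-other p w x≢)) (trans (code≗ x) (code-other q w′ x≢))

  encodes-injective : ∀ {s s′ t} → Encodes s t → Encodes s′ t → s ≡ s′
  encodes-injective {r , T , w} {r′ , T′ , w′} E E′ =
    let p≗q , w≡w′ = stage₂-determined P.parent Q.parent _ refl K≡K′ code≗ tops≡
        T≡T′ , r≡r′ = parents-determine G P.tree Q.tree P.parent Q.parent p≗q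
    in cong₂ _,_ r≡r′ (cong₂ _,_ T≡T′ (vec-ext w≡w′))
    where
    module P = Encodes E
    module Q = Encodes E′

    K K′ : Vec Bool (order G)
    K  = crossings P.p
    K′ = crossings Q.p

    codes : code K P.p w ≗ code K′ Q.p w′
    codes x = subst (λ y → code K P.p w y ≡ code K′ Q.p w′ y) (at-position x)
      (tabulate-injective (trans (sym P.values) Q.values) (position x))

    K≡K′ : K ≡ K′
    K≡K′ = Vec.tabulate-cong λ k → let x = lookup vs k in
      trans (sym (Coding.code-crossing P.parent P.outside x))
            (trans (cong (crossing (block x)) (codes x)) (Coding.code-crossing Q.parent Q.outside x))

    code≗ : code K P.p w ≗ code K Q.p w′
    code≗ = subst (λ K″ → code K P.p w ≗ code K″ Q.p w′) (sym K≡K′) codes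

    tops≡ : ∀ i → stage₂ K P.p (rep K (suc i)) ≡ stage₂ K Q.p (rep K (suc i))
    tops≡ i = trans (tabulate-injective (trans (sym P.tops) Q.tops) i)
      (cong (λ K″ → stage₂ K″ Q.p (rep K″ (suc i))) (sym K≡K′))

    vec-ext : (∀ i → Vec.lookup w i ≡ Vec.lookup w′ i) → w ≡ w′
    vec-ext eq = trans (sym (Vec.tabulate∘lookup w))
      (trans (Vec.tabulate-cong eq) (Vec.tabulate∘lookup w′))

  outsiders : Fin (suc m) → List V
  outsiders i = filter (λ x → ¬? (block x Fin.≟ i)) vs

  neighbours : Fin (order G) → List (Maybe V)
  neighbours k = map just (filter (lookup vs k ~?_) vs)

  sources : List (V × List (V × V) × Vec V (suc m))
  sources = cartesianProduct vs (cartesianProduct (spanningTrees G) (choices outsiders))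

  targets : List (Vec (Maybe V) (order G) × Vec (Maybe V) m)
  targets = cartesianProduct (choices neighbours) (choices λ _ → map just vs)

  encode : ∀ {s} → s ∈ sources → ∃ λ t → t ∈ targets × Encodes s t
  encode {r , T , w} s∈ =
    let _ , Tw∈ = ∈-cartesianProduct⁻ vs _ s∈
        T∈ , w∈ = ∈-cartesianProduct⁻ (spanningTrees G) _ Tw∈
        T⊆ , connected , _ = ∈-spanningTrees⁻ G T∈
        p , parent = parents G {T} r connected
        outside = λ i → proj₂ (∈-filter⁻ (λ x → ¬? (block x Fin.≟ i)) {xs = vs}
                                (∈-choices⁻ {L = outsiders} w∈ i))
    in _ , ∈-cartesianProduct⁺
             (∈-choices⁺ λ k → Coding.code-adjacent parent outside
               (joined⇒adjacent G T⊆ ∘ proj₂ parent) (lookup vs k))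
             (∈-choices⁺ λ i → ∈-just (Coding.stage₂-label parent i))
         , record { p = p ; tree = T∈ ; parent = parent ; outside = outside
                  ; values = refl ; tops = refl }
    where
    ∈-just : ∀ {y} → y ≢ nothing → y ∈ map just vs
    ∈-just {just x}  _  = ∈-map⁺ just (complete x)
    ∈-just {nothing} y≢ = contradiction refl y≢

  sources≤targets : order G * (τ G * product (tabulate (length ∘ outsiders)))
                    ≤ product (map (degree G) vs) * order G ^ m
  sources≤targets = begin
    order G * (τ G * product (tabulate (length ∘ outsiders)))
      ≡⟨ cong (λ k → order G * (τ G * k)) (length-choices outsiders) ⟨
    order G * (τ G * length (choices outsiders))
      ≡⟨ cong (order G *_) (length-cartesianProductWith _,_ (spanningTrees G) _) ⟨
    order G * length (cartesianProduct (spanningTrees G) (choices outsiders))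
      ≡⟨ length-cartesianProductWith _,_ vs _ ⟨
    length sources
      ≤⟨ length-≤-by Encodes sources-unique encode encodes-injective ⟩
    length targets
      ≡⟨ length-cartesianProductWith _,_ (choices neighbours) _ ⟩
    length (choices neighbours) * length (choices {n = m} λ _ → map just vs)
      ≡⟨ cong₂ _*_ neighbours-product vertices-power ⟩
    product (map (degree G) vs) * order G ^ m ∎
    where
    open ℕ.≤-Reasoning

    sources-unique = Unique.cartesianProduct⁺ unique
      (Unique.cartesianProduct⁺ (spanningTrees-unique G)
        (choices-unique {L = outsiders} λ _ → Unique.filter⁺ _ unique))

    neighbours-product : length (choices neighbours) ≡ product (map (degree G) vs)
    neighbours-product = trans (length-choices neighbours) (cong product
      (trans (List.tabulate-cong λ k → List.length-map just (filter (lookup vs k ~?_) vs))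
             (trans (sym (List.map-tabulate (lookup vs) (degree G)))
                    (cong (map (degree G)) (List.tabulate-lookup vs)))))

    vertices-power : length (choices {n = m} λ _ → map just vs) ≡ order G ^ m
    vertices-power = trans (length-choices {n = m} λ _ → map just vs)
      (trans (product-tabulate-const m _) (cong (_^ m) (List.length-map just vs)))

module _ {n : ℕ} (Gs : Fin n → FiniteGraph) where

  order-∇ : order (∇ Gs) ≡ sum (tabulate (order ∘ Gs))
  order-∇ = trans (length-concat (block Gs))
    (cong sum (List.tabulate-cong λ i →
      List.length-map {B = Σ (Fin n) λ j → FiniteGraph.V (Gs j)} (i ,_) (vertices (Gs i))))
    where
    length-concat : ∀ {A : Set} {k} (f : Fin k → List A) →
                    length (concat (tabulate f)) ≡ sum (tabulate (length ∘ f))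
    length-concat {k = zero}  f = refl
    length-concat {k = suc k} f =
      trans (List.length-++ (f zero)) (cong (λ l → length (f zero) + l) (length-concat (f ∘ suc)))

  order-outside-block : ∀ i → sum (tabulate (order ∘ Gs)) ∸ order (Gs i)
                            ≤ length (filter (λ x → ¬? (proj₁ x Fin.≟ i)) (vertices (∇ Gs)))
  order-outside-block i = begin
    sum (tabulate (order ∘ Gs)) ∸ order (Gs i)   ≡⟨ cong (_∸ order (Gs i)) order-∇ ⟨
    length vs ∸ order (Gs i)                     ≡⟨ cong (_∸ order (Gs i)) (length-filter-¬ in-block? vs) ⟩
    length inner + length outer ∸ order (Gs i)   ≤⟨ ℕ.∸-monoʳ-≤ (length inner + length outer) inner≤ ⟩
    length inner + length outer ∸ length inner   ≡⟨ ℕ.m+n∸m≡n (length inner) (length outer) ⟩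
    length outer                                 ∎
    where
    open ℕ.≤-Reasoning
    vs = vertices (∇ Gs)
    in-block? = λ (x : FiniteGraph.V (∇ Gs)) → proj₁ x Fin.≟ i
    inner = filter in-block? vs
    outer = filter (¬? ∘ in-block?) vs

    inner≤ : length inner ≤ order (Gs i)
    inner≤ = length-≤-by (λ x y → x ≡ (i , y)) (Unique.filter⁺ in-block? (FiniteGraph.unique (∇ Gs)))
      (λ x∈ → in-block (proj₂ (∈-filter⁻ in-block? {xs = vs} x∈)))
      (λ { refl refl → refl })
      where
      in-block : ∀ {x} → proj₁ x ≡ i → ∃ λ y → _ × x ≡ (i , y)
      in-block {_ , y} refl = y , FiniteGraph.complete (Gs i) y , refl

/-≤-* : ∀ a b c q .{{_ : NonZero q}} → a * q ≤ b * c → + a / 1 ≤ℚ (+ b / 1) *ℚ (+ c / q)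
/-≤-* a b c (suc q) aq≤bc = ℚ.toℚᵘ-cancel-≤ (begin
  toℚᵘ (+ a / 1)                           ≃⟨ ℚ.toℚᵘ-fromℚᵘ (ℚᵘ.mkℚᵘ (+ a) 0) ⟩
  ℚᵘ.mkℚᵘ (+ a) 0                          ≤⟨ ℚᵘ.*≤* numerators ⟩
  ℚᵘ.mkℚᵘ (+ b) 0 ℚᵘ.* ℚᵘ.mkℚᵘ (+ c) q     ≃⟨ ℚᵘ.*-cong (ℚ.toℚᵘ-fromℚᵘ (ℚᵘ.mkℚᵘ (+ b) 0))
                                                        (ℚ.toℚᵘ-fromℚᵘ (ℚᵘ.mkℚᵘ (+ c) q)) ⟨
  toℚᵘ (+ b / 1) ℚᵘ.* toℚᵘ (+ c / suc q)   ≃⟨ ℚ.toℚᵘ-homo-* (+ b / 1) (+ c / suc q) ⟨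
  toℚᵘ ((+ b / 1) *ℚ (+ c / suc q))        ∎)
  where
  open ℚᵘ.≤-Reasoning

  numerators : + a ℤ.* + (1 * suc q) ℤ.≤ (+ b ℤ.* + c) ℤ.* + 1
  numerators rewrite ℕ.*-identityˡ (suc q) | ℤ.*-identityʳ (+ b ℤ.* + c)
    | sym (ℤ.pos-* a (suc q)) | sym (ℤ.pos-* b c) = +≤+ aq≤bc

theorem5p1 : (n : ℕ) (2≤n : 2 ≤ n)
    (Gs : Fin n → FiniteGraph)
    (1≤vᵢ : ∀ i → 1 ≤ order (Gs i)) →
    let
    v = sum (tabulate (λ i → order (Gs i)))
    G = ∇ Gs
    in
    + τ G / 1 ≤ℚ
    (+ (v ^ (n ∸ 2)) / 1) *ℚ
    (_/_ (+ product (map (degree G) (vertices G)))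
    (product (tabulate (λ i → v ∸ order (Gs i))))
    {{∏[v∸vᵢ]≢0 Gs 2≤n 1≤vᵢ}})
theorem5p1 (suc zero) (s≤s ())
theorem5p1 (suc (suc m)) 2≤n Gs 1≤vᵢ =
  /-≤-* (τ G) (v ^ m) D Q {{∏[v∸vᵢ]≢0 Gs 2≤n 1≤vᵢ}}
    (ℕ.*-cancelˡ-≤ v {{>-nonZero (ℕ.≤-trans (1≤vᵢ zero) (≤sum (order ∘ Gs) zero))}} (begin
      v * (τ G * Q)             ≤⟨ ℕ.*-monoʳ-≤ v (ℕ.*-monoʳ-≤ (τ G)
                                     (product-tabulate-mono (order-outside-block Gs))) ⟩
      v * (τ G * outside)       ≡⟨ cong (_* (τ G * outside)) (order-∇ Gs) ⟨
      order G * (τ G * outside) ≤⟨ J.sources≤targets ⟩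
      D * order G ^ suc m       ≡⟨ cong (λ k → D * k ^ suc m) (order-∇ Gs) ⟩
      D * (v * v ^ m)           ≡⟨ ℕ.*-comm D (v * v ^ m) ⟩
      v * v ^ m * D             ≡⟨ ℕ.*-assoc v (v ^ m) D ⟩
      v * (v ^ m * D)           ∎))
  where
  open ℕ.≤-Reasoning
  v = sum (tabulate (order ∘ Gs))
  G = ∇ Gs
  D = product (map (degree G) (vertices G))
  Q = product (tabulate (λ i → v ∸ order (Gs i)))
  module J = JoinCode G proj₁ across (λ i → (i , lookup (vertices (Gs i)) (fromℕ< (1≤vᵢ i))) , refl)
  outside = product (tabulate (length ∘ J.outsiders))
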